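{- For any integer $a\geq 2$, there exists a graph $G$ with $\mathrm{diam}(G)=2$ such that $L_2(G)=a$.
   Context: All graphs are finite, undirected and simple. $\mathrm{diam}(G)$ is the diameter and $N[v]=\{v\}\cup N(v)$ is the closed neighbourhood of $v$. A set $B\subseteq V(G)$ is a $2$-limited packing if $|N[v]\cap B|\le 2$ for every vertex $v$ of $G$; $L_2(G)$ is the maximum cardinality of a $2$-limited packing in $G$. -}

module Defs where

open import Data.Fin.Base using (Fin)
open import Data.Fin.Properties using (_≟_)
open import Data.Fin.Subset using (Subset; ∣_∣; _∩_)
open import Data.Nat.Base using (ℕ; suc; _≤_)
open import Data.Product.Base using (Σ-syntax; ∃-syntax; _×_)
open import Data.Vec.Base using (tabulate)
open import Level using (0ℓ)
open import Relation.Binary.Core using (Rel)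
open import Relation.Binary.Construct.Closure.ReflexiveTransitive using (Star; fold)
open import Relation.Binary.Definitions using (Symmetric; Irreflexive; Decidable)
open import Relation.Binary.PropositionalEquality using (_≡_)
open import Relation.Nullary.Decidable using (does; _⊎-dec_)
open import Relation.Unary using (Pred)

IsMinimum : Pred ℕ 0ℓ → ℕ → Set
IsMinimum P m = P m × (∀ k → P k → m ≤ k)

IsMaximum : Pred ℕ 0ℓ → ℕ → Set
IsMaximum P m = P m × (∀ k → P k → k ≤ m)

-- Vertices are numbered by Fin order.  Adjacency is required to be decidable
-- so that neighbourhoods are finite subsets with a cardinality.
record Graph : Set₁ where
  field
    order  : ℕ
    Adj    : Rel (Fin order) 0ℓ
    adj?   : Decidable Adj
    sym    : Symmetric Adj
    irrefl : Irreflexive _≡_ Adj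

  Vertex : Set
  Vertex = Fin order

  VertexSet : Set
  VertexSet = Subset order

  Walk : Rel Vertex 0ℓ
  Walk = Star Adj

  length : ∀ {u v} → Walk u v → ℕ
  length = fold (λ _ _ → ℕ) (λ _ → suc) 0

  Connected : Set
  Connected = ∀ u v → Walk u v

  IsDistance : Vertex → Vertex → ℕ → Set
  IsDistance u v = IsMinimum (λ k → Σ[ w ∈ Walk u v ] length w ≡ k)

  -- A disconnected graph has no finite diameter, and IsDistance u v has no
  -- solution across components; hence the connectedness requirement.
  IsDiameter : ℕ → Set
  IsDiameter d =
    Connected × IsMaximum (λ k → ∃[ u ] ∃[ v ] IsDistance u v k) d

  N[_] : Vertex → VertexSet
  N[ v ] = tabulate (λ u → does (u ≟ v ⊎-dec adj? v u))

  IsLimitedPacking : ℕ → VertexSet → Set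
  IsLimitedPacking k B = ∀ v → ∣ N[ v ] ∩ B ∣ ≤ k

  -- IsL k m states that L_k(G) = m.
  IsL : ℕ → ℕ → Set
  IsL k = IsMaximum (λ m → ∃[ B ] IsLimitedPacking k B × ∣ B ∣ ≡ m)

{-# OPTIONS --safe #-}
-- Take an independent set of a base vertices and, for every pair (i , j) of
-- them, a hub adjacent to exactly i and j; let the hubs form a clique.  The base
-- is a 2-limited packing, since a closed neighbourhood meets it in at most
-- two vertices.  Conversely, suppose a 2-limited packing P contains a hub.  Two
-- distinct base vertices i, j in P would give N[(i , j)] three members of P, so
-- P has at most one base vertex i, whence P ⊆ N[(i , i)] and ∣ P ∣ ≤ 2 ≤ a.
module Submission where

open import Defs
open import Data.Bool.Base using (true)
open import Data.Empty using (⊥)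
open import Data.Fin.Base using (Fin; zero; suc; combine)
open import Data.Fin.Properties using (_≟_; any?; +↔⊎; *↔×)
open import Data.Fin.Subset
  using (Subset; inside; outside; ∣_∣; _∈_; _∉_; _⊆_; _∩_; _∪_; ⁅_⁆)
  renaming (⊤ to full; ⊥ to empty)
open import Data.Fin.Subset.Properties
open import Data.Nat.Base using (ℕ; suc; _+_; _*_; _≤_; z≤n; s≤s)
open import Data.Nat.Properties
  using (≤-refl; ≤-reflexive; ≤-trans; m≤n⇒m≤1+n; +-suc; +-identityʳ; <⇒≱)
open import Data.Product.Base using (Σ-syntax; _×_; _,_; proj₁; proj₂)
open import Data.Product.Properties using (≡-dec)
open import Data.Sum.Base using (_⊎_; inj₁; inj₂; map)
open import Data.Sum.Properties using (inj₁-injective)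
open import Data.Sum.Function.Propositional using (_⊎-↔_)
open import Data.Vec.Base using ([]; _∷_; _++_)
open import Data.Vec.Properties
  using (lookup-++ˡ; lookup-++ʳ; lookup-replicate; lookup∘tabulate; lookup⇒[]=; []=⇒lookup)
open import Function.Base using (_∘_; _on_)
open import Function.Bundles using (_↔_; Inverse)
open import Function.Construct.Composition using (_↔-∘_)
open import Function.Construct.Identity using (↔-id)
open import Level using (0ℓ)
open import Relation.Binary.Construct.Closure.ReflexiveTransitive using (ε; _◅_)
open import Relation.Binary.Core using (Rel)
open import Relation.Binary.Definitions using (Symmetric; Irreflexive; Decidable)
open import Relation.Binary.PropositionalEquality
  using (_≡_; _≢_; refl; sym; trans; cong; cong₂; subst; subst₂; ≢-sym)
open import Relation.Nullary using (¬_; Dec; yes; no; contradiction)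
open import Relation.Nullary.Decidable using (dec-true; does; _⊎-dec_; ¬?)

-- Cardinalities of finite subsets.

∣p++q∣≡∣p∣+∣q∣ : ∀ {m n} (p : Subset m) (q : Subset n) → ∣ p ++ q ∣ ≡ ∣ p ∣ + ∣ q ∣
∣p++q∣≡∣p∣+∣q∣ []            q = refl
∣p++q∣≡∣p∣+∣q∣ (inside  ∷ p) q = cong suc (∣p++q∣≡∣p∣+∣q∣ p q)
∣p++q∣≡∣p∣+∣q∣ (outside ∷ p) q = ∣p++q∣≡∣p∣+∣q∣ p q

∣p∪q∣≤∣p∣+∣q∣ : ∀ {n} (p q : Subset n) → ∣ p ∪ q ∣ ≤ ∣ p ∣ + ∣ q ∣
∣p∪q∣≤∣p∣+∣q∣ []            []            = z≤n
∣p∪q∣≤∣p∣+∣q∣ (outside ∷ p) (outside ∷ q) = ∣p∪q∣≤∣p∣+∣q∣ p q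
∣p∪q∣≤∣p∣+∣q∣ (outside ∷ p) (inside  ∷ q)
  rewrite +-suc ∣ p ∣ ∣ q ∣ = s≤s (∣p∪q∣≤∣p∣+∣q∣ p q)
∣p∪q∣≤∣p∣+∣q∣ (inside  ∷ p) (outside ∷ q) = s≤s (∣p∪q∣≤∣p∣+∣q∣ p q)
∣p∪q∣≤∣p∣+∣q∣ (inside  ∷ p) (inside  ∷ q)
  rewrite +-suc ∣ p ∣ ∣ q ∣ = s≤s (m≤n⇒m≤1+n (∣p∪q∣≤∣p∣+∣q∣ p q))

p⊆⁅x⁆∪⁅y⁆⇒∣p∣≤2 : ∀ {n} {p : Subset n} x y →
  (∀ {z} → z ∈ p → z ≡ x ⊎ z ≡ y) → ∣ p ∣ ≤ 2
p⊆⁅x⁆∪⁅y⁆⇒∣p∣≤2 {p = p} x y pxy =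
  ≤-trans (p⊆q⇒∣p∣≤∣q∣ p⊆)
    (≤-trans (∣p∪q∣≤∣p∣+∣q∣ ⁅ x ⁆ ⁅ y ⁆)
      (≤-reflexive (cong₂ _+_ (∣⁅x⁆∣≡1 x) (∣⁅x⁆∣≡1 y))))
  where
  p⊆ : p ⊆ ⁅ x ⁆ ∪ ⁅ y ⁆
  p⊆ z∈p with pxy z∈p
  ... | inj₁ refl = x∈p∪q⁺ (inj₁ (x∈⁅x⁆ _))
  ... | inj₂ refl = x∈p∪q⁺ (inj₂ (x∈⁅x⁆ _))

three-members⇒3≤∣p∣ : ∀ {n} {p : Subset n} {x y z} →
  x ∈ p → y ∈ p → z ∈ p → y ≢ x → z ≢ x → z ≢ y → 3 ≤ ∣ p ∣
three-members⇒3≤∣p∣ x∈p y∈p z∈p y≢x z≢x z≢y =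
  -- Removing `x` and then `y` strictly lowers the cardinality each time, and `z` still remains.
  ≤-trans (s≤s (≤-trans (s≤s (≤-trans (s≤s z≤n) (x∈p⇒∣p-x∣<∣p∣ z∈p-x-y)))
                        (x∈p⇒∣p-x∣<∣p∣ y∈p-x)))
          (x∈p⇒∣p-x∣<∣p∣ x∈p)
  where
  y∈p-x   = x∈p∧x≢y⇒x∈p-y y∈p y≢x
  z∈p-x-y = x∈p∧x≢y⇒x∈p-y (x∈p∧x≢y⇒x∈p-y z∈p z≢x) z≢y

does-true⁻ : ∀ {A : Set} (a? : Dec A) → does a? ≡ true → A
does-true⁻ (yes a) _ = a

module _ (G : Graph) where
  open Graph G using (Vertex; Adj; adj?; N[_]; IsLimitedPacking)

  ∈N⁺ : ∀ {u v} → u ≡ v ⊎ Adj v u → u ∈ N[ v ]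
  ∈N⁺ {u} {v} h = lookup⇒[]= u _
    (trans (lookup∘tabulate _ u) (dec-true (u ≟ v ⊎-dec adj? v u) h))

  ∈N⁻ : ∀ {u v} → u ∈ N[ v ] → u ≡ v ⊎ Adj v u
  ∈N⁻ {u} {v} u∈N = does-true⁻ (u ≟ v ⊎-dec adj? v u)
    (trans (sym (lookup∘tabulate _ u)) ([]=⇒lookup u∈N))

  packing-in-N : ∀ {k B v} → IsLimitedPacking k B →
    (∀ {u} → u ∈ B → u ≡ v ⊎ Adj v u) → ∣ B ∣ ≤ k
  packing-in-N {v = v} packing B⊆N =
    ≤-trans (p⊆q⇒∣p∣≤∣q∣ (λ u∈B → x∈p∩q⁺ (∈N⁺ (B⊆N u∈B) , u∈B))) (packing v)

-- The hub graph.

module HubGraph (a : ℕ) where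

  -- Hubs are indexed by ordered pairs, diagonal included: the hub `(i , i)` has `i` as its only
  -- base neighbour.
  Label : Set
  Label = Fin a ⊎ Fin a × Fin a

  pattern base i  = inj₁ i
  pattern hub i j = inj₂ (i , j)

  _~_ : Rel Label 0ℓ
  base _  ~ base _  = ⊥
  base i  ~ hub k l = i ≡ k ⊎ i ≡ l
  hub k l ~ base i  = i ≡ k ⊎ i ≡ l
  inj₂ e  ~ inj₂ f  = e ≢ f

  ~-sym : Symmetric _~_
  ~-sym {base _}  {hub _ _} h = h
  ~-sym {hub _ _} {base _}  h = h
  ~-sym {inj₂ _}  {inj₂ _}  h = ≢-sym h

  ~-irrefl : Irreflexive _≡_ _~_
  ~-irrefl {inj₂ _} refl h = h refl

  hubs-near : ∀ e f → inj₂ e ≡ inj₂ {A = Fin a} f ⊎ inj₂ f ~ inj₂ e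
  hubs-near e f with ≡-dec _≟_ _≟_ e f
  ... | yes e≡f = inj₁ (cong inj₂ e≡f)
  ... | no  e≢f = inj₂ (≢-sym e≢f)

  _~?_ : Decidable _~_
  base _  ~? base _  = no λ ()
  base i  ~? hub k l = i ≟ k ⊎-dec i ≟ l
  hub k l ~? base i  = i ≟ k ⊎-dec i ≟ l
  inj₂ e  ~? inj₂ f  = ¬? (≡-dec _≟_ _≟_ e f)

  -- The base vertices occupy the first `a` indices and the hubs the rest, so the base set is a
  -- concatenation of two constant vectors.
  labelling : Fin (a + a * a) ↔ Label
  labelling = (↔-id (Fin a) ⊎-↔ *↔×) ↔-∘ +↔⊎

  open Inverse labelling using ()
    renaming (to to label; from to vertex;
              strictlyInverseˡ to label-vertex; strictlyInverseʳ to vertex-label)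

  graph : Graph
  graph = record
    { order  = a + a * a
    ; Adj    = _~_ on label
    ; adj?   = λ u v → label u ~? label v
    ; sym    = λ {u} {v} → ~-sym {label u} {label v}
    ; irrefl = λ u≡v → ~-irrefl (cong label u≡v)
    }

  open Graph graph hiding (sym)

  -- Permits case analysis on a vertex as base or hub, although it is really an index in `Fin`.
  by-label : ∀ {ℓ} (P : Vertex → Set ℓ) → (∀ s → P (vertex s)) → ∀ v → P v
  by-label P P-vertex v = subst P (vertex-label v) (P-vertex (label v))

  vertex-injective : ∀ s t → vertex s ≡ vertex t → s ≡ t
  vertex-injective s t eq =
    trans (sym (label-vertex s)) (trans (cong label eq) (label-vertex t))

  edge : ∀ s t → s ~ t → Adj (vertex s) (vertex t)
  edge s t = subst₂ _~_ (sym (label-vertex s)) (sym (label-vertex t))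

  unedge : ∀ s t → Adj (vertex s) (vertex t) → s ~ t
  unedge s t = subst₂ _~_ (label-vertex s) (label-vertex t)

  vertex∈N⁺ : ∀ s t → s ≡ t ⊎ t ~ s → vertex s ∈ N[ vertex t ]
  vertex∈N⁺ s t = ∈N⁺ graph ∘ map (cong vertex) (edge t s)

  vertex∈N⁻ : ∀ s t → vertex s ∈ N[ vertex t ] → s ≡ t ⊎ t ~ s
  vertex∈N⁻ s t = map (vertex-injective s t) (unedge t s) ∘ ∈N⁻ graph

  -- The diameter.

  ShortWalk : Rel Vertex 0ℓ
  ShortWalk u v = Σ[ w ∈ Walk u v ] length w ≤ 2

  one-step : ∀ s t → s ~ t → ShortWalk (vertex s) (vertex t)
  one-step s t s~t = edge s t s~t ◅ ε , s≤s z≤n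

  two-step : ∀ s r t → s ~ r → r ~ t → ShortWalk (vertex s) (vertex t)
  two-step s r t s~r r~t = edge s r s~r ◅ edge r t r~t ◅ ε , ≤-refl

  -- Two bases are joined through their common hub, by a walk out and back if they coincide. A base
  -- `i` reaches any hub through `(i , i)`, by the clique.
  labels-close : ∀ s t → ShortWalk (vertex s) (vertex t)
  labels-close s@(base i) t@(base j) =
    two-step s (hub i j) t (inj₁ refl) (inj₂ refl)
  labels-close s@(base i) t@(inj₂ e) with ≡-dec _≟_ _≟_ (i , i) e
  ... | yes refl = one-step s t (inj₁ refl)
  ... | no  ii≢e = two-step s (hub i i) t (inj₁ refl) ii≢e
  labels-close s@(inj₂ e) t@(base i) with ≡-dec _≟_ _≟_ e (i , i)
  ... | yes refl = one-step s t (inj₁ refl)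
  ... | no  e≢ii = two-step s (hub i i) t e≢ii (inj₁ refl)
  labels-close s@(inj₂ e) t@(inj₂ f) with ≡-dec _≟_ _≟_ e f
  ... | yes refl = ε , z≤n
  ... | no  e≢f  = one-step s t e≢f

  close : ∀ u v → ShortWalk u v
  close = by-label _ λ s → by-label _ (labels-close s)

  base-walk-length : ∀ {i j} → i ≢ j →
    (w : Walk (vertex (base i)) (vertex (base j))) → 2 ≤ length w
  base-walk-length {i} {j} i≢j = go
    (i≢j ∘ inj₁-injective ∘ vertex-injective (base i) (base j))
    (unedge (base i) (base j))
    where
    -- The endpoints are generalised to variables so that matching on the walk can unify them.
    go : ∀ {u v} → u ≢ v → ¬ Adj u v → (w : Walk u v) → 2 ≤ length w
    go u≢v _    ε           = contradiction refl u≢v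
    go _   ¬u~v (u~v ◅ ε)   = contradiction u~v ¬u~v
    go _   _    (_ ◅ _ ◅ _) = s≤s (s≤s z≤n)

  diameter-2 : ∀ {i j : Fin a} → i ≢ j → IsDiameter 2
  diameter-2 {i} {j} i≢j =
      (λ u v → proj₁ (close u v))
    , (vertex (base i) , vertex (base j)
      -- The walk between two bases has exactly two edges by computation.
      , (proj₁ walk , refl)
      , λ { _ (w , refl) → base-walk-length i≢j w })
    -- A distance is minimal among walk lengths, hence bounded by that of the short walk.
    , λ { _ (u , v , _ , minimal) →
          let w , short = close u v in ≤-trans (minimal _ (w , refl)) short }
    where walk = labels-close (base i) (base j)

  -- A packing of size `a`.

  bases : VertexSet
  bases = full {a} ++ empty {a * a}

  ∣bases∣≡a : ∣ bases ∣ ≡ a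
  ∣bases∣≡a = trans (∣p++q∣≡∣p∣+∣q∣ (full {a}) (empty {a * a}))
    (trans (cong₂ _+_ (∣⊤∣≡n a) (∣⊥∣≡0 (a * a))) (+-identityʳ a))

  base∈bases : ∀ i → vertex (base i) ∈ bases
  base∈bases i = lookup⇒[]= _ bases
    (trans (lookup-++ˡ full (empty {a * a}) i) (lookup-replicate i inside))

  hub∉bases : ∀ i j → vertex (hub i j) ∉ bases
  hub∉bases i j h∈bases
    with () ← trans (sym ([]=⇒lookup h∈bases))
      (trans (lookup-++ʳ (full {a}) empty (combine i j)) (lookup-replicate (combine i j) outside))

  -- Counting a base vertex as both of its own endpoints treats bases and hubs uniformly: the base
  -- vertices in any closed neighbourhood are among the two endpoints.
  endpoints : Label → Fin a × Fin a
  endpoints (base i) = i , i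
  endpoints (inj₂ e) = e

  base-near⇒endpoint : ∀ {i} t → base i ≡ t ⊎ t ~ base i →
    i ≡ proj₁ (endpoints t) ⊎ i ≡ proj₂ (endpoints t)
  base-near⇒endpoint _         (inj₁ refl) = inj₁ refl
  base-near⇒endpoint (hub _ _) (inj₂ h)    = h

  bases-packing : IsLimitedPacking 2 bases
  bases-packing = by-label _ λ t → p⊆⁅x⁆∪⁅y⁆⇒∣p∣≤2
    (vertex (base (proj₁ (endpoints t)))) (vertex (base (proj₂ (endpoints t))))
    (λ {z} → by-label (λ z → z ∈ N[ vertex t ] ∩ bases → z ≡ _ ⊎ z ≡ _) (near t) z)
    where
    near : ∀ t s → vertex s ∈ N[ vertex t ] ∩ bases →
      vertex s ≡ vertex (base (proj₁ (endpoints t))) ⊎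
      vertex s ≡ vertex (base (proj₂ (endpoints t)))
    near t s s∈ with s | x∈p∩q⁻ N[ vertex t ] bases s∈
    ... | base i  | s∈N , _ = map (cong (vertex ∘ inj₁)) (cong (vertex ∘ inj₁))
      (base-near⇒endpoint t (vertex∈N⁻ (base i) t s∈N))
    ... | hub i j | _ , s∈bases = contradiction s∈bases (hub∉bases i j)

  -- The upper bound for an arbitrary packing.

  module _ {P : VertexSet} (packing : IsLimitedPacking 2 P) where

    -- For `i ≢ j`, the closed neighbourhood of the hub `(i , j)` would contain both bases and the
    -- hub `(k , l)`, even when the two hubs coincide.
    base-unique : ∀ {k l i j} → vertex (hub k l) ∈ P →
      vertex (base i) ∈ P → vertex (base j) ∈ P → i ≡ j
    base-unique {k} {l} {i} {j} h∈P i∈P j∈P with i ≟ j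
    ... | yes i≡j = i≡j
    ... | no  i≢j = contradiction (packing (vertex (hub i j))) (<⇒≱
      (three-members⇒3≤∣p∣
        (x∈p∩q⁺ (vertex∈N⁺ (hub k l) (hub i j) (hubs-near (k , l) (i , j)) , h∈P))
        (x∈p∩q⁺ (vertex∈N⁺ (base i) (hub i j) (inj₂ (inj₁ refl)) , i∈P))
        (x∈p∩q⁺ (vertex∈N⁺ (base j) (hub i j) (inj₂ (inj₂ refl)) , j∈P))
        (base≢hub ∘ vertex-injective (base i) (hub k l))
        (base≢hub ∘ vertex-injective (base j) (hub k l))
        (i≢j ∘ sym ∘ inj₁-injective ∘ vertex-injective (base j) (base i))))
      where
      base≢hub : ∀ {i : Fin a} {e : Fin a × Fin a} → inj₁ i ≢ inj₂ e
      base≢hub ()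

    with-hub : ∀ {k l} → vertex (hub k l) ∈ P → ∣ P ∣ ≤ 2
    with-hub {k} {l} h∈P with any? (λ i → vertex (base i) ∈? P)
    -- The only base in `P` is `i`, and the hub `(i , i)` sees it along with all hubs.
    ... | yes (i , i∈P) = packing-in-N graph {v = vertex (hub i i)} packing
      λ {u} → by-label (λ u → u ∈ P → u ≡ _ ⊎ Adj _ u)
        (λ { (base j) j∈P → inj₂ (edge (hub i i) (base j) (inj₁ (base-unique {k} {l} h∈P j∈P i∈P)))
           ; (inj₂ e) _   → map (cong vertex) (edge (hub i i) (inj₂ e)) (hubs-near e (i , i)) }) u
    -- `P` consists of hubs only, so the given hub sees all of it.
    ... | no no-base = packing-in-N graph {v = vertex (hub k l)} packing
      λ {u} → by-label (λ u → u ∈ P → u ≡ _ ⊎ Adj _ u)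
        (λ { (base j) j∈P → contradiction (j , j∈P) no-base
           ; (inj₂ e) _   → map (cong vertex) (edge (hub k l) (inj₂ e)) (hubs-near e (k , l)) }) u

    packing-size : 2 ≤ a → ∣ P ∣ ≤ a
    packing-size 2≤a with any? (λ k → any? (λ l → vertex (hub k l) ∈? P))
    -- Here `2 ≤ a` is essential: a packing with a hub is bounded by 2 only.
    ... | yes (_ , _ , h∈P) = ≤-trans (with-hub h∈P) 2≤a
    ... | no  no-hub = ≤-trans (p⊆q⇒∣p∣≤∣q∣ P⊆bases) (≤-reflexive ∣bases∣≡a)
      where
      P⊆bases : P ⊆ bases
      P⊆bases {z} = by-label (λ z → z ∈ P → z ∈ bases)
        (λ { (base i)  _   → base∈bases i
           ; (hub k l) h∈P → contradiction (k , l , h∈P) no-hub }) z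

theorem4p4 : ∀ (a : ℕ) → 2 ≤ a →
    Σ[ G ∈ Graph ] (Graph.IsDiameter G 2 × Graph.IsL G 2 a)
theorem4p4 a@(suc (suc _)) 2≤a@(s≤s (s≤s _)) =
    graph
  -- Since `2 ≤ a`, the indices 0 and 1 give two distinct bases, which are at distance 2.
  , diameter-2 {zero} {suc zero} (λ ())
  , (bases , bases-packing , ∣bases∣≡a)
  , λ { _ (P , packing , refl) → packing-size {P} packing 2≤a }
  where open HubGraph a
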